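{- For every integer $w\geq 3$, $$\sum_{i=1}^{w-2}\sigma(w-i,i)=(w-1)\,\lambda(w).$$
   Context: For integers $t\geq 1$ and $n\geq 1$ let $S_n^{(t)}=\sum_{k=1}^{n}\frac{1}{(2k-1)^t}$, and for integers $s\geq 2$, $t\geq 1$ let $\sigma(s,t)=\sum_{n\geq 1}\frac{S_n^{(t)}}{n^s}$. For real $s>1$, $\lambda(s)=\sum_{n\geq 1}\frac{1}{(2n-1)^s}=(1-2^{ -s})\zeta(s)$. -}

module Defs where

open import Algebra.Bundles.Raw using (RawMonoid)
open import Data.Fin.Base using (Fin; toℕ)
open import Data.Fin.Properties using (toℕ<n)
open import Data.Integer.Base as ℤ using (+_; +[1+_]; -[1+_])
import Data.Integer.Properties as ℤ
open import Data.Nat.Base as ℕ using (ℕ; zero; suc; NonZero)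
import Data.Nat.Properties as ℕ
open import Data.Product.Base using (∃-syntax; _,_; proj₁; proj₂)
open import Data.Rational.Base hiding (NonZero; _≃_)
open import Data.Rational.Properties
open import Data.Rational.Solver using (module +-*-Solver)
import Data.Rational.Unnormalised.Base as ℚᵘ
import Data.Rational.Unnormalised.Properties as ℚᵘ
open import Data.Sum.Base using (inj₁; inj₂)
open import Level using (0ℓ)
open import Relation.Binary.PropositionalEquality

open +-*-Solver using (solve; _:=_; _:+_; _:*_; _:-_; con) renaming (:-_ to :-′_)

-- Real numbers are Cauchy sequences of rationals, with _≃ℝ_ as equality.

IsCauchy : (ℕ → ℚ) → Set
IsCauchy x = ∀ ε → 0ℚ < ε →
  ∃[ N ] (∀ m n → N ℕ.≤ m → N ℕ.≤ n → ∣ x m - x n ∣ < ε)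

record ℝ : Set where
  constructor mkℝ
  field
    seq    : ℕ → ℚ
    cauchy : IsCauchy seq

open ℝ public

infix 4 _≃ℝ_
infixl 6 _+ℝ_

_≃ℝ_ : ℝ → ℝ → Set
x ≃ℝ y = ∀ ε → 0ℚ < ε →
  ∃[ N ] (∀ n → N ℕ.≤ n → ∣ seq x n - seq y n ∣ < ε)

0ℝ : ℝ
0ℝ = mkℝ (λ _ → 0ℚ) (λ ε 0<ε → 0 , λ _ _ _ _ → 0<ε)

+-cauchy : ∀ x y → IsCauchy x → IsCauchy y → IsCauchy (λ n → x n + y n)
+-cauchy x y cx cy ε 0<ε = Nx ℕ.⊔ Ny , bound
  where
  0<½ε : 0ℚ < ½ * ε
  0<½ε = subst (_< ½ * ε) (*-zeroʳ ½) (*-monoʳ-<-pos ½ 0<ε)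

  Nx = proj₁ (cx (½ * ε) 0<½ε)
  Ny = proj₁ (cy (½ * ε) 0<½ε)

  bound : ∀ m n → Nx ℕ.⊔ Ny ℕ.≤ m → Nx ℕ.⊔ Ny ℕ.≤ n →
          ∣ (x m + y m) - (x n + y n) ∣ < ε
  bound m n N≤m N≤n = begin-strict
    ∣ (x m + y m) - (x n + y n) ∣
      ≡⟨ cong ∣_∣ (solve 4 (λ a b c d → (a :+ b) :- (c :+ d) := (a :- c) :+ (b :- d))
                           refl (x m) (y m) (x n) (y n)) ⟩
    ∣ (x m - x n) + (y m - y n) ∣
      ≤⟨ ∣p+q∣≤∣p∣+∣q∣ (x m - x n) (y m - y n) ⟩
    ∣ x m - x n ∣ + ∣ y m - y n ∣
      <⟨ +-mono-<
           (proj₂ (cx (½ * ε) 0<½ε) m n (ℕ.m⊔n≤o⇒m≤o Nx Ny N≤m) (ℕ.m⊔n≤o⇒m≤o Nx Ny N≤n))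
           (proj₂ (cy (½ * ε) 0<½ε) m n (ℕ.m⊔n≤o⇒n≤o Nx Ny N≤m) (ℕ.m⊔n≤o⇒n≤o Nx Ny N≤n)) ⟩
    ½ * ε + ½ * ε
      ≡⟨ solve 1 (λ e → con ½ :* e :+ con ½ :* e := e) refl ε ⟩
    ε ∎
    where open ≤-Reasoning

_+ℝ_ : ℝ → ℝ → ℝ
x +ℝ y = mkℝ (λ n → seq x n + seq y n) (+-cauchy (seq x) (seq y) (cauchy x) (cauchy y))

+ℝ-rawMonoid : RawMonoid 0ℓ 0ℓ
+ℝ-rawMonoid = record { Carrier = ℝ ; _≈_ = _≃ℝ_ ; _∙_ = _+ℝ_ ; ε = 0ℝ }

open import Algebra.Definitions.RawMonoid +ℝ-rawMonoid public
  using () renaming (sum to sumℝ; _×_ to _·ℝ_)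

-- Families are indexed from 0: a k is the (k+1)-st term of the series.

partialSum : (ℕ → ℚ) → ℕ → ℚ
partialSum a zero    = 0ℚ
partialSum a (suc n) = partialSum a n + a n

Summable : (ℕ → ℚ) → Set
Summable a = IsCauchy (partialSum a)

Σ∞ : (a : ℕ → ℚ) → Summable a → ℝ
Σ∞ a a-summable = mkℝ (partialSum a) a-summable

recip : (d : ℕ) → .{{NonZero d}} → ℚ
recip d = + 1 / d

recipPow : (d s : ℕ) → .{{NonZero d}} → ℚ
recipPow d s = recip (d ℕ.^ s) {{ℕ.m^n≢0 d s}}

-- The (k+1)-st odd number is 2(k+1)-1 = 2k+1.

S : (t n : ℕ) → ℚ
S t n = partialSum (λ k → recipPow (suc (2 ℕ.* k)) t) n

σ-term : (s t : ℕ) → ℕ → ℚ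
σ-term s t k = S t (suc k) * recipPow (suc k) s

lambda-term : (s : ℕ) → ℕ → ℚ
lambda-term s k = recipPow (suc (2 ℕ.* k)) s

p≤q⇒0≤q-p : ∀ {p q} → p ≤ q → 0ℚ ≤ q - p
p≤q⇒0≤q-p {p} {q} p≤q = subst (_≤ q - p) (+-inverseʳ p) (+-monoˡ-≤ (- p) p≤q)

0≤q-p⇒p≤q : ∀ {p q} → 0ℚ ≤ q - p → p ≤ q
0≤q-p⇒p≤q {p} {q} 0≤ = subst₂ _≤_ (+-identityˡ p)
  (solve 2 (λ p q → (q :- p) :+ p := q) refl p q) (+-monoˡ-≤ p 0≤)

0≤+ : ∀ {p q} → 0ℚ ≤ p → 0ℚ ≤ q → 0ℚ ≤ p + q
0≤+ 0≤p 0≤q = +-mono-≤ 0≤p 0≤q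

*-mono-≤ : ∀ {p q r s} → 0ℚ ≤ p → 0ℚ ≤ s → p ≤ q → r ≤ s → p * r ≤ q * s
*-mono-≤ {p} {q} {r} {s} 0≤p 0≤s p≤q r≤s = ≤-trans
  (*-monoˡ-≤-nonNeg p {{nonNegative 0≤p}} r≤s)
  (*-monoʳ-≤-nonNeg s {{nonNegative 0≤s}} p≤q)

0≤* : ∀ {p q} → 0ℚ ≤ p → 0ℚ ≤ q → 0ℚ ≤ p * q
0≤* {p} {q} 0≤p 0≤q = subst (_≤ p * q) (*-zeroʳ p)
  (*-monoˡ-≤-nonNeg p {{nonNegative 0≤p}} 0≤q)

0≤p*p : ∀ p → 0ℚ ≤ p * p
0≤p*p p with ≤-total 0ℚ p
... | inj₁ 0≤p = 0≤* 0≤p 0≤p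
... | inj₂ p≤0 = subst (0ℚ ≤_) (solve 1 (λ p → (:-′ p) :* (:-′ p) := p :* p) refl p)
                   (0≤* (neg-antimono-≤ p≤0) (neg-antimono-≤ p≤0))

fromℕ : ℕ → ℚ
fromℕ n = + n / 1

fromℕ-+ : ∀ m n → fromℕ (m ℕ.+ n) ≡ fromℕ m + fromℕ n
fromℕ-+ m n = toℚᵘ-injective (begin-equality
  toℚᵘ (fromℕ (m ℕ.+ n))             ≃⟨ toℚᵘ-fromℚᵘ (ℚᵘ.mkℚᵘ (+ (m ℕ.+ n)) 0) ⟩
  ℚᵘ.mkℚᵘ (+ (m ℕ.+ n)) 0            ≃⟨ ℚᵘ.*≡* (cong (ℤ._* + 1) (sym (cong₂ ℤ._+_ (ℤ.*-identityʳ (+ m)) (ℤ.*-identityʳ (+ n))))) ⟩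
  ℚᵘ.mkℚᵘ (+ m) 0 ℚᵘ.+ ℚᵘ.mkℚᵘ (+ n) 0
    ≃⟨ ℚᵘ.+-cong (toℚᵘ-fromℚᵘ (ℚᵘ.mkℚᵘ (+ m) 0)) (toℚᵘ-fromℚᵘ (ℚᵘ.mkℚᵘ (+ n) 0)) ⟨
  toℚᵘ (fromℕ m) ℚᵘ.+ toℚᵘ (fromℕ n) ≃⟨ toℚᵘ-homo-+ (fromℕ m) (fromℕ n) ⟨
  toℚᵘ (fromℕ m + fromℕ n)           ∎)
  where open ℚᵘ.≤-Reasoning

fromℕ-* : ∀ m n → fromℕ (m ℕ.* n) ≡ fromℕ m * fromℕ n
fromℕ-* zero    n = sym (*-zeroˡ (fromℕ n))
fromℕ-* (suc m) n = begin
  fromℕ (n ℕ.+ m ℕ.* n)           ≡⟨ fromℕ-+ n (m ℕ.* n) ⟩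
  fromℕ n + fromℕ (m ℕ.* n)       ≡⟨ cong (λ z → fromℕ n + z) (fromℕ-* m n) ⟩
  fromℕ n + fromℕ m * fromℕ n
    ≡⟨ solve 2 (λ m n → n :+ m :* n := (con 1ℚ :+ m) :* n) refl (fromℕ m) (fromℕ n) ⟩
  (1ℚ + fromℕ m) * fromℕ n        ≡⟨ cong (_* fromℕ n) (fromℕ-+ 1 m) ⟨
  fromℕ (suc m) * fromℕ n         ∎
  where open ≡-Reasoning

0≤fromℕ : ∀ n → 0ℚ ≤ fromℕ n
0≤fromℕ n = nonNegative⁻¹ (fromℕ n) {{normalize-nonNeg n 1}}

fromℕ-mono : ∀ {m n} → m ℕ.≤ n → fromℕ m ≤ fromℕ n
fromℕ-mono {m} {n} m≤n = subst₂ _≤_ (+-identityʳ (fromℕ m))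
  (trans (sym (fromℕ-+ m (n ℕ.∸ m))) (cong fromℕ (ℕ.m+[n∸m]≡n m≤n)))
  (+-monoʳ-≤ (fromℕ m) (0≤fromℕ (n ℕ.∸ m)))

0≤recip : ∀ d .{{_ : NonZero d}} → 0ℚ ≤ recip d
0≤recip d = nonNegative⁻¹ (recip d) {{normalize-nonNeg 1 d}}

fromℕ*recip : ∀ d .{{_ : NonZero d}} → fromℕ d * recip d ≡ 1ℚ
fromℕ*recip d@(suc d-1) = toℚᵘ-injective (begin-equality
  toℚᵘ (fromℕ d * recip d)               ≃⟨ toℚᵘ-homo-* (fromℕ d) (recip d) ⟩
  toℚᵘ (fromℕ d) ℚᵘ.* toℚᵘ (recip d)
    ≃⟨ ℚᵘ.*-cong (toℚᵘ-fromℚᵘ (ℚᵘ.mkℚᵘ (+ d) 0)) (toℚᵘ-fromℚᵘ (ℚᵘ.mkℚᵘ (+ 1) d-1)) ⟩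
  ℚᵘ.mkℚᵘ (+ d) 0 ℚᵘ.* ℚᵘ.mkℚᵘ (+ 1) d-1
    ≃⟨ ℚᵘ.*≡* (cong +_ (trans (cong (ℕ._* 1) (ℕ.*-identityʳ d)) (trans (ℕ.*-comm d 1) (cong (1 ℕ.*_) (sym (ℕ.*-identityˡ d)))))) ⟩
  toℚᵘ 1ℚ                                ∎)
  where open ℚᵘ.≤-Reasoning

recip-antimono : ∀ {m n} .{{_ : NonZero m}} .{{_ : NonZero n}} →
                 m ℕ.≤ n → recip n ≤ recip m
recip-antimono {m} {n} m≤n = begin
  recip n                        ≡⟨ *-identityˡ (recip n) ⟨
  1ℚ * recip n                   ≡⟨ cong (_* recip n) (fromℕ*recip m) ⟨
  fromℕ m * recip m * recip n
    ≤⟨ *-mono-≤ (0≤* (0≤fromℕ m) (0≤recip m)) (0≤recip n)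
         (*-mono-≤ (0≤fromℕ m) (0≤recip m) (fromℕ-mono m≤n) ≤-refl) ≤-refl ⟩
  fromℕ n * recip m * recip n
    ≡⟨ solve 3 (λ a b c → a :* b :* c := (a :* c) :* b) refl (fromℕ n) (recip m) (recip n) ⟩
  fromℕ n * recip n * recip m    ≡⟨ cong (_* recip m) (fromℕ*recip n) ⟩
  1ℚ * recip m                   ≡⟨ *-identityˡ (recip m) ⟩
  recip m                        ∎
  where open ≤-Reasoning

0≤recipPow : ∀ d s .{{_ : NonZero d}} → 0ℚ ≤ recipPow d s
0≤recipPow d s = 0≤recip (d ℕ.^ s) {{ℕ.m^n≢0 d s}}

recipPow-antimono : ∀ {c d s t} .{{_ : NonZero c}} .{{_ : NonZero d}} →
                    c ℕ.≤ d → s ℕ.≤ t → recipPow d t ≤ recipPow c s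
recipPow-antimono {c} {d} {s} {t} c≤d s≤t =
  recip-antimono {{ℕ.m^n≢0 c s}} {{ℕ.m^n≢0 d t}}
    (ℕ.≤-trans (ℕ.^-monoˡ-≤ s c≤d) (ℕ.^-monoʳ-≤ d s≤t))

archimedean : ∀ ε → 0ℚ < ε → ∃[ q ] (recip (suc q) < ε)
archimedean ε@(mkℚ +[1+ n ] d _) _ = suc d , toℚᵘ-cancel-< (begin-strict
  toℚᵘ (recip (2 ℕ.+ d)) ≃⟨ toℚᵘ-fromℚᵘ (ℚᵘ.mkℚᵘ (+ 1) (suc d)) ⟩
  ℚᵘ.mkℚᵘ (+ 1) (suc d)  <⟨ ℚᵘ.*<* (ℤ.+<+ (subst (ℕ._< suc n ℕ.* (2 ℕ.+ d)) (sym (ℕ.*-identityˡ (suc d))) (ℕ.<-≤-trans (ℕ.n<1+n (suc d)) (ℕ.m≤n*m (2 ℕ.+ d) (suc n))))) ⟩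
  toℚᵘ ε                 ∎)
  where open ℚᵘ.≤-Reasoning
archimedean (mkℚ (+ 0) d _)    (*<* (ℤ.+<+ ()))
archimedean (mkℚ -[1+ n ] d _) (*<* ())

∣p∣<ε : ∀ {p ε} → p < ε → - p < ε → ∣ p ∣ < ε
∣p∣<ε {p} {ε} p<ε -p<ε with ∣p∣≡p∨∣p∣≡-p p
... | inj₁ eq = subst (_< ε) (sym eq) p<ε
... | inj₂ eq = subst (_< ε) (sym eq) -p<ε

partialSum-mono-≤ : ∀ {a b} → (∀ k → a k ≤ b k) → ∀ n → partialSum a n ≤ partialSum b n
partialSum-mono-≤ a≤b zero    = ≤-refl
partialSum-mono-≤ a≤b (suc n) = +-mono-≤ (partialSum-mono-≤ a≤b n) (a≤b n)

partialSum-increasing : ∀ {a} → (∀ k → 0ℚ ≤ a k) →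
                        ∀ {m n} → m ℕ.≤ n → partialSum a m ≤ partialSum a n
partialSum-increasing {a} 0≤a m≤n = go (ℕ.≤⇒≤′ m≤n)
  where
  go : ∀ {m n} → m ℕ.≤′ n → partialSum a m ≤ partialSum a n
  go ℕ.≤′-refl             = ≤-refl
  go (ℕ.≤′-step {n} m≤′n) = ≤-trans (go m≤′n)
    (subst (_≤ partialSum a (suc n)) (+-identityʳ (partialSum a n))
      (+-monoʳ-≤ (partialSum a n) (0≤a n)))

summable-by-tails : ∀ {a} → (∀ k → 0ℚ ≤ a k) →
  (∀ ε → 0ℚ < ε →
    ∃[ N ] (∀ n → N ℕ.≤ n → partialSum a n - partialSum a N < ε)) →
  Summable a
summable-by-tails {a} 0≤a tails ε 0<ε = N , λ m n N≤m N≤n →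
  ∣p∣<ε (half m n N≤m N≤n)
    (subst (_< ε) (solve 2 (λ x y → y :- x := :-′ (x :- y)) refl (A m) (A n))
      (half n m N≤n N≤m))
  where
  A = partialSum a
  N = proj₁ (tails ε 0<ε)

  half : ∀ m n → N ℕ.≤ m → N ℕ.≤ n → A m - A n < ε
  half m n N≤m N≤n = ≤-<-trans
    (+-monoʳ-≤ (A m) (neg-antimono-≤ (partialSum-increasing 0≤a N≤n)))
    (proj₂ (tails ε 0<ε) m N≤m)

summable-by-comparison : ∀ {a b} → (∀ k → 0ℚ ≤ a k) → (∀ k → a k ≤ b k) →
                         Summable b → Summable a
summable-by-comparison {a} {b} 0≤a a≤b b-summable = summable-by-tails 0≤a tails
  where
  A = partialSum a
  B = partialSum b

  tail≤ : ∀ {m n} → m ℕ.≤′ n → A n - A m ≤ B n - B m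
  tail≤ {m} ℕ.≤′-refl = ≤-reflexive (trans (+-inverseʳ (A m)) (sym (+-inverseʳ (B m))))
  tail≤ {m} (ℕ.≤′-step {n} m≤′n) = subst₂ _≤_ (shift (A n) (a n) (A m)) (shift (B n) (b n) (B m))
    (+-mono-≤ (tail≤ m≤′n) (a≤b n))
    where
    shift : ∀ x y z → (x - z) + y ≡ (x + y) - z
    shift = solve 3 (λ x y z → (x :- z) :+ y := (x :+ y) :- z) refl

  p≤∣p∣ : ∀ p → p ≤ ∣ p ∣
  p≤∣p∣ p with ≤-total 0ℚ p
  ... | inj₁ 0≤p = ≤-reflexive (sym (0≤p⇒∣p∣≡p 0≤p))
  ... | inj₂ p≤0 = ≤-trans p≤0 (0≤∣p∣ p)

  tails : ∀ ε → 0ℚ < ε → ∃[ N ] (∀ n → N ℕ.≤ n → A n - A N < ε)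
  tails ε 0<ε with b-summable ε 0<ε
  ... | N , close = N , λ n N≤n → ≤-<-trans (tail≤ (ℕ.≤⇒≤′ N≤n))
          (≤-<-trans (p≤∣p∣ (B n - B N)) (close n N N≤n ℕ.≤-refl))

-- Convergence of σ(2,1), from the bounds S n ² ≤ n and, for n ≥ 1,
-- S (n+1) / (n+1)² ≤ (S n + 1) / n - (S (n+1) + 1) / (n+1).

module Convergence where
  odd : ℕ → ℕ
  odd k = suc (2 ℕ.* k)

  o : ℕ → ℚ
  o k = recipPow (odd k) 1

  H : ℕ → ℚ
  H = S 1

  0≤o : ∀ k → 0ℚ ≤ o k
  0≤o k = 0≤recipPow (odd k) 1

  o≤1 : ∀ k → o k ≤ 1ℚ
  o≤1 k = recipPow-antimono {1} {odd k} {0} {1} (ℕ.s≤s ℕ.z≤n) ℕ.z≤n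

  odd*o : ∀ k → (fromℕ k + fromℕ k + 1ℚ) * o k ≡ 1ℚ
  odd*o k = begin
    (fromℕ k + fromℕ k + 1ℚ) * o k
      ≡⟨ cong (_* o k) (begin
          fromℕ k + fromℕ k + 1ℚ ≡⟨ solve 1 (λ x → x :+ x :+ con 1ℚ := con 1ℚ :+ con (fromℕ 2) :* x) refl (fromℕ k) ⟩
          1ℚ + fromℕ 2 * fromℕ k ≡⟨ cong (λ z → 1ℚ + z) (fromℕ-* 2 k) ⟨
          1ℚ + fromℕ (2 ℕ.* k)   ≡⟨ fromℕ-+ 1 (2 ℕ.* k) ⟨
          fromℕ (odd k)          ≡⟨ cong fromℕ (ℕ.*-identityʳ (odd k)) ⟨
          fromℕ (odd k ℕ.^ 1)    ∎) ⟩
    fromℕ (odd k ℕ.^ 1) * o k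
      ≡⟨ fromℕ*recip (odd k ℕ.^ 1) {{ℕ.m^n≢0 (odd k) 1}} ⟩
    1ℚ ∎
    where open ≡-Reasoning

  0≤S : ∀ t n → 0ℚ ≤ S t n
  0≤S t zero    = ≤-refl
  0≤S t (suc n) = 0≤+ (0≤S t n) (0≤recipPow (odd n) t)

  H≤n : ∀ n → H n ≤ fromℕ n
  H≤n zero    = ≤-refl
  H≤n (suc n) = ≤-trans (+-mono-≤ (H≤n n) (o≤1 n))
    (≤-reflexive (trans (+-comm (fromℕ n) 1ℚ) (sym (fromℕ-+ 1 n))))

  H²≤n : ∀ n → H n * H n ≤ fromℕ n
  H²≤n zero    = ≤-refl
  H²≤n (suc n) = begin
    (H n + o n) * (H n + o n)
      ≡⟨ solve 2 (λ h o → (h :+ o) :* (h :+ o) := h :* h :+ (h :+ h :+ o) :* o) refl (H n) (o n) ⟩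
    H n * H n + (H n + H n + o n) * o n
      ≤⟨ +-mono-≤ (H²≤n n) (*-monoʳ-≤-nonNeg (o n) {{nonNegative (0≤o n)}}
           (+-mono-≤ (+-mono-≤ (H≤n n) (H≤n n)) (o≤1 n))) ⟩
    fromℕ n + (fromℕ n + fromℕ n + 1ℚ) * o n ≡⟨ cong (λ z → fromℕ n + z) (odd*o n) ⟩
    fromℕ n + 1ℚ ≡⟨ +-comm (fromℕ n) 1ℚ ⟩
    1ℚ + fromℕ n ≡⟨ fromℕ-+ 1 n ⟨
    fromℕ (suc n) ∎
    where open ≤-Reasoning

  -- b k = (S n + 1) / n for n = k + 1
  b : ℕ → ℚ
  b k = (H (suc k) + 1ℚ) * recip (suc k)

  0≤b : ∀ k → 0ℚ ≤ b k
  0≤b k = 0≤* (0≤+ (0≤S 1 (suc k)) (0≤fromℕ 1)) (0≤recip (suc k))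

  recip-step : ∀ n .{{_ : NonZero n}} → recip n ≡ recip (suc n) + recip n * recip (suc n)
  recip-step n = begin
    u                          ≡⟨ *-identityʳ u ⟨
    u * 1ℚ                     ≡⟨ cong (u *_) (fromℕ*recip (suc n)) ⟨
    u * (fromℕ (suc n) * v)    ≡⟨ cong (λ z → u * (z * v)) (fromℕ-+ 1 n) ⟩
    u * ((1ℚ + fromℕ n) * v)
      ≡⟨ solve 3 (λ n u v → u :* ((con 1ℚ :+ n) :* v) := (n :* u) :* v :+ u :* v) refl (fromℕ n) u v ⟩
    fromℕ n * u * v + u * v    ≡⟨ cong (λ z → z * v + u * v) (fromℕ*recip n) ⟩
    1ℚ * v + u * v             ≡⟨ cong (_+ u * v) (*-identityˡ v) ⟩
    v + u * v                  ∎
    where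
    open ≡-Reasoning
    u = recip n
    v = recip (suc n)

  recipPow-2 : ∀ n .{{_ : NonZero n}} → recipPow n 2 ≡ recip n * recip n
  recipPow-2 n = begin
    w                             ≡⟨ *-identityʳ w ⟨
    w * 1ℚ                        ≡⟨ cong (w *_) (cong₂ _*_ (fromℕ*recip n) (fromℕ*recip n)) ⟨
    w * ((fromℕ n * u) * (fromℕ n * u))
      ≡⟨ solve 3 (λ w n u → w :* ((n :* u) :* (n :* u)) := ((n :* n) :* w) :* (u :* u)) refl w (fromℕ n) u ⟩
    ((fromℕ n * fromℕ n) * w) * (u * u)
      ≡⟨ cong (λ z → z * w * (u * u)) (trans (sym (fromℕ-* n n)) (cong (λ z → fromℕ (n ℕ.* z)) (sym (ℕ.*-identityʳ n)))) ⟩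
    (fromℕ (n ℕ.^ 2) * w) * (u * u)
      ≡⟨ cong (_* (u * u)) (fromℕ*recip (n ℕ.^ 2) {{ℕ.m^n≢0 n 2}}) ⟩
    1ℚ * (u * u)                  ≡⟨ *-identityˡ (u * u) ⟩
    u * u                         ∎
    where
    open ≡-Reasoning
    u = recip n
    w = recipPow n 2

  o≤recip : ∀ k → o k ≤ recip (suc k)
  o≤recip k = recip-antimono {suc k} {odd k ℕ.^ 1} {{_}} {{ℕ.m^n≢0 (odd k) 1}}
    (subst (suc k ℕ.≤_) (sym (ℕ.*-identityʳ (odd k))) (ℕ.s≤s (ℕ.m≤n*m k 2)))

  telescope : ∀ k → σ-term 2 1 (suc k) + b (suc k) ≤ b k
  telescope k = 0≤q-p⇒p≤q (subst (0ℚ ≤_) (sym difference)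
    (0≤+ (0≤* (0≤* (0≤S 1 (suc n)) (0≤recip (suc n))) (p≤q⇒0≤q-p (recip-antimono (ℕ.n≤1+n n))))
         (0≤* (0≤recip n) (p≤q⇒0≤q-p (o≤recip n)))))
    where
    open ≡-Reasoning
    n = suc k
    h = H n
    e = o n
    u = recip n
    v = recip (suc n)

    difference : b k - (σ-term 2 1 n + b n) ≡ (h + e) * v * (u - v) + u * (v - e)
    difference = begin
      (h + 1ℚ) * u - ((h + e) * recipPow (suc n) 2 + (h + e + 1ℚ) * v)
        ≡⟨ cong (λ z → (h + 1ℚ) * u - ((h + e) * z + (h + e + 1ℚ) * v)) (recipPow-2 (suc n)) ⟩
      (h + 1ℚ) * u - ((h + e) * (v * v) + (h + e + 1ℚ) * v)
        ≡⟨ solve 4 (λ h e u v →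
             (h :+ con 1ℚ) :* u :- ((h :+ e) :* (v :* v) :+ (h :+ e :+ con 1ℚ) :* v)
             := (h :+ e :+ con 1ℚ) :* u :- (h :+ e :+ con 1ℚ) :* v :- e :* u :- (h :+ e) :* (v :* v))
             refl h e u v ⟩
      (h + e + 1ℚ) * u - (h + e + 1ℚ) * v - e * u - (h + e) * (v * v)
        ≡⟨ cong (λ z → (h + e + 1ℚ) * z - (h + e + 1ℚ) * v - e * u - (h + e) * (v * v)) (recip-step n) ⟩
      (h + e + 1ℚ) * (v + u * v) - (h + e + 1ℚ) * v - e * u - (h + e) * (v * v)
        ≡⟨ solve 4 (λ h e u v →
             (h :+ e :+ con 1ℚ) :* (v :+ u :* v) :- (h :+ e :+ con 1ℚ) :* v :- e :* u :- (h :+ e) :* (v :* v)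
             := (h :+ e) :* v :* (u :- v) :+ u :* (v :- e))
             refl h e u v ⟩
      (h + e) * v * (u - v) + u * (v - e) ∎

  0≤σ-term : ∀ s t k → 0ℚ ≤ σ-term s t k
  0≤σ-term s t k = 0≤* (0≤S t (suc k)) (0≤recipPow (suc k) s)

  tail≤b : ∀ {k l} → k ℕ.≤′ l →
           partialSum (σ-term 2 1) (suc l) - partialSum (σ-term 2 1) (suc k) + b l ≤ b k
  tail≤b {k} ℕ.≤′-refl = ≤-reflexive
    (trans (cong (_+ b k) (+-inverseʳ (partialSum (σ-term 2 1) (suc k)))) (+-identityˡ (b k)))
  tail≤b {k} (ℕ.≤′-step {l} k≤′l) = begin
    A (suc l) + a (suc l) - A (suc k) + b (suc l)
      ≡⟨ solve 4 (λ x y z w → x :+ y :- z :+ w := x :- z :+ (y :+ w)) refl (A (suc l)) (a (suc l)) (A (suc k)) (b (suc l)) ⟩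
    A (suc l) - A (suc k) + (a (suc l) + b (suc l)) ≤⟨ +-monoʳ-≤ (A (suc l) - A (suc k)) (telescope l) ⟩
    A (suc l) - A (suc k) + b l ≤⟨ tail≤b k≤′l ⟩
    b k ∎
    where
    open ≤-Reasoning
    a = σ-term 2 1
    A = partialSum a

  b-small : ∀ q k → suc q ℕ.* (2 ℕ.+ suc q) ℕ.≤ suc k → b k ≤ recip (suc q)
  b-small q k large = begin
    b k ≡⟨ *-identityʳ (b k) ⟨
    b k * 1ℚ ≡⟨ cong (b k *_) (fromℕ*recip (suc q)) ⟨
    b k * (Q * δ) ≡⟨ solve 3 (λ b Q δ → b :* (Q :* δ) := ((Q :+ Q) :* b) :* (con ½ :* δ)) refl (b k) Q δ ⟩
    ((Q + Q) * b k) * (½ * δ) ≤⟨ *-monoʳ-≤-nonNeg (½ * δ) {{nonNegative (0≤* 0≤½ (0≤recip (suc q)))}} 2Qb≤2 ⟩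
    fromℕ 2 * (½ * δ) ≡⟨ solve 1 (λ δ → con (fromℕ 2) :* (con ½ :* δ) := δ) refl δ ⟩
    δ ∎
    where
    open ≤-Reasoning
    n = suc k
    Q = fromℕ (suc q)
    δ = recip (suc q)
    u = recip n
    h = H n

    0≤½ : 0ℚ ≤ ½
    0≤½ = nonNegative⁻¹ ½

    2Qh≤ : (Q + Q) * h ≤ fromℕ n + Q * Q
    2Qh≤ = ≤-trans
      (0≤q-p⇒p≤q (subst (0ℚ ≤_)
        (solve 2 (λ h Q → (h :- Q) :* (h :- Q) := (h :* h :+ Q :* Q) :- (Q :+ Q) :* h) refl h Q)
        (0≤p*p (h - Q))))
      (+-monoˡ-≤ (Q * Q) (H²≤n n))

    large′ : Q * (fromℕ 2 + Q) ≤ fromℕ n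
    large′ = subst (_≤ fromℕ n)
      (trans (fromℕ-* (suc q) (2 ℕ.+ suc q)) (cong (Q *_) (fromℕ-+ 2 (suc q))))
      (fromℕ-mono large)

    2Qb≤2 : (Q + Q) * b k ≤ fromℕ 2
    2Qb≤2 = begin
      (Q + Q) * ((h + 1ℚ) * u)
        ≡⟨ solve 3 (λ Q h u → (Q :+ Q) :* ((h :+ con 1ℚ) :* u) := ((Q :+ Q) :* h :+ (Q :+ Q)) :* u) refl Q h u ⟩
      ((Q + Q) * h + (Q + Q)) * u
        ≤⟨ *-monoʳ-≤-nonNeg u {{nonNegative (0≤recip n)}} (+-monoˡ-≤ (Q + Q) 2Qh≤) ⟩
      (fromℕ n + Q * Q + (Q + Q)) * u
        ≡⟨ cong (_* u) (solve 2 (λ n Q → n :+ Q :* Q :+ (Q :+ Q) := n :+ Q :* (con (fromℕ 2) :+ Q)) refl (fromℕ n) Q) ⟩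
      (fromℕ n + Q * (fromℕ 2 + Q)) * u
        ≤⟨ *-monoʳ-≤-nonNeg u {{nonNegative (0≤recip n)}} (+-monoʳ-≤ (fromℕ n) large′) ⟩
      (fromℕ n + fromℕ n) * u ≡⟨ *-distribʳ-+ u (fromℕ n) (fromℕ n) ⟩
      fromℕ n * u + fromℕ n * u ≡⟨ cong₂ _+_ (fromℕ*recip n) (fromℕ*recip n) ⟩
      fromℕ 2 ∎

  σ-2-1-summable : Summable (σ-term 2 1)
  σ-2-1-summable = summable-by-tails (0≤σ-term 2 1) tails
    where
    A = partialSum (σ-term 2 1)

    tails : ∀ ε → 0ℚ < ε → ∃[ N ] (∀ n → N ℕ.≤ n → A n - A N < ε)
    tails ε 0<ε with archimedean ε 0<ε
    ... | q , δ<ε = suc K , bound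
      where
      K = suc q ℕ.* (2 ℕ.+ suc q)

      bound : ∀ n → suc K ℕ.≤ n → A n - A (suc K) < ε
      bound (suc l) (ℕ.s≤s K≤l) = ≤-<-trans
        (≤-trans
          (subst (_≤ A (suc l) - A (suc K) + b l) (+-identityʳ (A (suc l) - A (suc K)))
            (+-monoʳ-≤ (A (suc l) - A (suc K)) (0≤b l)))
          (≤-trans (tail≤b (ℕ.≤⇒≤′ K≤l)) (b-small q K (ℕ.n≤1+n K))))
        δ<ε

open Convergence

σ-summable : ∀ s t → 2 ℕ.≤ s → 1 ℕ.≤ t → Summable (σ-term s t)
σ-summable s t 2≤s 1≤t = summable-by-comparison (0≤σ-term s t)
  (λ k → *-mono-≤ (0≤S t (suc k)) (0≤recipPow (suc k) 2)
    (partialSum-mono-≤ (λ j → recipPow-antimono {odd j} {odd j} ℕ.≤-refl 1≤t) (suc k))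
    (recipPow-antimono {suc k} {suc k} ℕ.≤-refl 2≤s))
  σ-2-1-summable

lambda-summable : ∀ s → 1 ℕ.< s → Summable (lambda-term s)
lambda-summable s 1<s = summable-by-comparison
  (λ k → 0≤recipPow (odd k) s)
  (λ k → ≤-trans (recipPow-antimono {suc k} {odd k} (ℕ.s≤s (ℕ.m≤n*m k 2)) 1<s)
    (subst (_≤ σ-term 2 1 k) (*-identityˡ (recipPow (suc k) 2))
      (*-monoʳ-≤-nonNeg (recipPow (suc k) 2) {{nonNegative (0≤recipPow (suc k) 2)}}
        (partialSum-increasing 0≤o {1} {suc k} (ℕ.s≤s ℕ.z≤n)))))
  σ-2-1-summable

σ : (s t : ℕ) → 2 ℕ.≤ s → 1 ℕ.≤ t → ℝ
σ s t 2≤s 1≤t = Σ∞ (σ-term s t) (σ-summable s t 2≤s 1≤t)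

lambda : (s : ℕ) → 1 ℕ.< s → ℝ
lambda s 1<s = Σ∞ (lambda-term s) (lambda-summable s 1<s)

i≤w-2⇒2≤w-i : ∀ w → 3 ℕ.≤ w → (i : Fin (w ℕ.∸ 2)) → 2 ℕ.≤ w ℕ.∸ suc (toℕ i)
i≤w-2⇒2≤w-i w 3≤w i = subst (ℕ._≤ w ℕ.∸ suc (toℕ i))
  (ℕ.m∸[m∸n]≡n (ℕ.≤-trans (ℕ.n≤1+n 2) 3≤w)) (ℕ.∸-monoʳ-≤ w (toℕ<n i))

{-# OPTIONS --safe #-}

-- Put m = w - 2, x = 1/n, y = 1/o with o odd, o < 2n.  The geometric sum over i of
-- x^(w-i) y^i equals x (y^m - x^m) / (n - o) when n ≠ o, and m y^w when n = o.  The
-- numbers n - o are symmetric about 0, so the x^m part cancels on summing over o.  For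
-- fixed o, 1 / (n (n - o)) = (1/(n - o) - 1/n) / o telescopes to harmonic numbers: the
-- sum over n ≤ N is (m + 1) y^w up to y^(w-1) (H_N - H_{N-o}) when o ≤ N, and just
-- - y^(w-1) (H_N - H_{o-N-1}) when o > N.  The total deviation at N is O((1 + H_N) / N).

module Submission where

open import Defs
open import Data.Nat.Base using (ℕ; suc; _∸_; _≤_; z≤n; s≤s)
open import Data.Nat.Properties using (<⇒≤)
open import Data.Fin.Base using (toℕ)

open import Data.Fin.Base using (Fin; zero; suc)
open import Data.Nat.Base as ℕ using (zero; NonZero)
import Data.Nat.Properties as ℕ
open import Data.Product.Base using (∃-syntax; _,_)
open import Data.Rational.Base renaming (_≤_ to _≤ℚ_) hiding (NonZero; _≃_)
open import Data.Rational.Properties hiding (<⇒≤)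
open import Data.Rational.Solver using (module +-*-Solver)
open import Data.Sum.Base using ([_,_]′)
open import Relation.Binary.PropositionalEquality

open +-*-Solver using (solve; _:=_; _:+_; _:*_; _:-_; con) renaming (:-_ to :-′_)
open Convergence using (odd; o; 0≤S; b; b-small; recipPow-2)

-- Partial sums

partialSum-cong : ∀ {a c} → (∀ k → a k ≡ c k) → ∀ n → partialSum a n ≡ partialSum c n
partialSum-cong a≡c zero    = refl
partialSum-cong a≡c (suc n) = cong₂ _+_ (partialSum-cong a≡c n) (a≡c n)

partialSum-mono-< : ∀ {a c} n → (∀ k → k ℕ.< n → a k ≤ℚ c k) → partialSum a n ≤ℚ partialSum c n
partialSum-mono-< zero    a≤c = ≤-refl
partialSum-mono-< (suc n) a≤c =
  +-mono-≤ (partialSum-mono-< n (λ k k<n → a≤c k (ℕ.m<n⇒m<1+n k<n))) (a≤c n ℕ.≤-refl)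

partialSum-const : ∀ c n → partialSum (λ _ → c) n ≡ fromℕ n * c
partialSum-const c zero    = sym (*-zeroˡ c)
partialSum-const c (suc n) = begin
  partialSum (λ _ → c) n + c ≡⟨ cong (_+ c) (partialSum-const c n) ⟩
  fromℕ n * c + c            ≡⟨ solve 2 (λ n c → n :* c :+ c := (con 1ℚ :+ n) :* c) refl (fromℕ n) c ⟩
  (1ℚ + fromℕ n) * c         ≡⟨ cong (_* c) (fromℕ-+ 1 n) ⟨
  fromℕ (suc n) * c          ∎
  where open ≡-Reasoning

partialSum-+ : ∀ a c n → partialSum (λ k → a k + c k) n ≡ partialSum a n + partialSum c n
partialSum-+ a c zero    = refl
partialSum-+ a c (suc n) = trans (cong (_+ (a n + c n)) (partialSum-+ a c n))
  (solve 4 (λ x y z w → x :+ y :+ (z :+ w) := x :+ z :+ (y :+ w)) refl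
    (partialSum a n) (partialSum c n) (a n) (c n))

partialSum-*ˡ : ∀ x a n → partialSum (λ k → x * a k) n ≡ x * partialSum a n
partialSum-*ˡ x a zero    = sym (*-zeroʳ x)
partialSum-*ˡ x a (suc n) =
  trans (cong (_+ x * a n) (partialSum-*ˡ x a n)) (sym (*-distribˡ-+ x (partialSum a n) (a n)))

partialSum-*ʳ : ∀ x a n → partialSum (λ k → a k * x) n ≡ partialSum a n * x
partialSum-*ʳ x a n = trans (partialSum-cong (λ k → *-comm (a k) x) n)
  (trans (partialSum-*ˡ x a n) (*-comm x (partialSum a n)))

partialSum-swap : ∀ (a : ℕ → ℕ → ℚ) m n →
  partialSum (λ i → partialSum (a i) n) m ≡ partialSum (λ j → partialSum (λ i → a i j) m) n
partialSum-swap a zero    n = sym (trans (partialSum-const 0ℚ n) (*-zeroʳ (fromℕ n)))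
partialSum-swap a (suc m) n = trans (cong (_+ partialSum (a m) n) (partialSum-swap a m n))
  (sym (partialSum-+ (λ j → partialSum (λ i → a i j) m) (a m) n))

partialSum-head : ∀ a n → partialSum a (suc n) ≡ a 0 + partialSum (λ k → a (suc k)) n
partialSum-head a zero    = +-comm 0ℚ (a 0)
partialSum-head a (suc n) = trans (cong (_+ a (suc n)) (partialSum-head a n))
  (+-assoc (a 0) (partialSum (λ k → a (suc k)) n) (a (suc n)))

-- Addition of reals is pointwise on sequences, so only the direction of recursion needs care:
-- `sumℝ` peels off the first summand and `partialSum` the last, which `partialSum-head` reconciles.
seq-sumℝ : ∀ {m} (g : Fin m → ℝ) a N → (∀ i → seq (g i) N ≡ a (toℕ i)) →
           seq (sumℝ g) N ≡ partialSum a m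
seq-sumℝ {zero}  g a N eq = refl
seq-sumℝ {suc m} g a N eq = trans
  (cong₂ _+_ (eq zero) (seq-sumℝ (λ i → g (suc i)) (λ j → a (suc j)) N (λ i → eq (suc i))))
  (sym (partialSum-head a m))

seq-·ℝ : ∀ m x N → seq (m ·ℝ x) N ≡ fromℕ m * seq x N
seq-·ℝ zero    x N = sym (*-zeroˡ (seq x N))
seq-·ℝ (suc m) x N = begin
  seq x N + seq (m ·ℝ x) N     ≡⟨ cong (λ z → seq x N + z) (seq-·ℝ m x N) ⟩
  seq x N + fromℕ m * seq x N
    ≡⟨ solve 2 (λ m x → x :+ m :* x := (con 1ℚ :+ m) :* x) refl (fromℕ m) (seq x N) ⟩
  (1ℚ + fromℕ m) * seq x N     ≡⟨ cong (_* seq x N) (fromℕ-+ 1 m) ⟨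
  fromℕ (suc m) * seq x N      ∎
  where open ≡-Reasoning

-- Reciprocals

recip-unique : ∀ d .{{_ : NonZero d}} {r} → fromℕ d * r ≡ 1ℚ → r ≡ recip d
recip-unique d {r} dr≡1 = begin
  r                       ≡⟨ *-identityˡ r ⟨
  1ℚ * r                  ≡⟨ cong (_* r) (fromℕ*recip d) ⟨
  fromℕ d * recip d * r
    ≡⟨ solve 3 (λ d u r → d :* u :* r := d :* r :* u) refl (fromℕ d) (recip d) r ⟩
  fromℕ d * r * recip d   ≡⟨ cong (_* recip d) dr≡1 ⟩
  1ℚ * recip d            ≡⟨ *-identityˡ (recip d) ⟩
  recip d                 ∎
  where open ≡-Reasoning

recip-* : ∀ c d .{{_ : NonZero c}} .{{_ : NonZero d}} .{{_ : NonZero (c ℕ.* d)}} →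
          recip (c ℕ.* d) ≡ recip c * recip d
recip-* c d = sym (recip-unique (c ℕ.* d) (begin
  fromℕ (c ℕ.* d) * (recip c * recip d)       ≡⟨ cong (_* (recip c * recip d)) (fromℕ-* c d) ⟩
  fromℕ c * fromℕ d * (recip c * recip d)
    ≡⟨ solve 4 (λ c d u v → c :* d :* (u :* v) := (c :* u) :* (d :* v)) refl
         (fromℕ c) (fromℕ d) (recip c) (recip d) ⟩
  fromℕ c * recip c * (fromℕ d * recip d)     ≡⟨ cong₂ _*_ (fromℕ*recip c) (fromℕ*recip d) ⟩
  1ℚ                                          ∎))
  where open ≡-Reasoning

recipPow-suc : ∀ d s .{{_ : NonZero d}} → recipPow d (suc s) ≡ recip d * recipPow d s
recipPow-suc d s {{d≢0}} = recip-* d (d ℕ.^ s) {{d≢0}} {{ℕ.m^n≢0 d s}} {{ℕ.m^n≢0 d (suc s)}}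

recipPow-1 : ∀ d .{{_ : NonZero d}} → recipPow d 1 ≡ recip d
recipPow-1 d = trans (recipPow-suc d 0) (*-identityʳ (recip d))

recip≤2recip : ∀ c d .{{_ : NonZero c}} .{{_ : NonZero d}} → d ≤ 2 ℕ.* c →
               recip c ≤ℚ fromℕ 2 * recip d
recip≤2recip c@(suc _) d d≤2c = begin
  recip c                         ≡⟨ solve 1 (λ u → u := con (fromℕ 2) :* (con ½ :* u)) refl (recip c) ⟩
  fromℕ 2 * (recip 2 * recip c)   ≡⟨ cong (fromℕ 2 *_) (recip-* 2 c) ⟨
  fromℕ 2 * recip (2 ℕ.* c)       ≤⟨ *-monoˡ-≤-nonNeg (fromℕ 2) (recip-antimono d≤2c) ⟩
  fromℕ 2 * recip d               ∎
  where open ≤-Reasoning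

-- The factor c - d stays explicit so that multiplying by `ρ c d` or `δ c d` turns it into 1 -
-- `δ c d` or 0.
recip-difference : ∀ c d .{{_ : NonZero c}} .{{_ : NonZero d}} →
  recip d ≡ recip c + recip c * recip d * (fromℕ c - fromℕ d)
recip-difference c d = begin
  y                                       ≡⟨ solve 2 (λ x y → y := x :+ (con 1ℚ :* y :- con 1ℚ :* x)) refl x y ⟩
  x + (1ℚ * y - 1ℚ * x)
    ≡⟨ cong₂ (λ p q → x + (p * y - q * x)) (fromℕ*recip c) (fromℕ*recip d) ⟨
  x + (fromℕ c * x * y - fromℕ d * y * x)
    ≡⟨ solve 4 (λ c d x y → x :+ (c :* x :* y :- d :* y :* x) := x :+ x :* y :* (c :- d)) refl
         (fromℕ c) (fromℕ d) x y ⟩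
  x + x * y * (fromℕ c - fromℕ d)         ∎
  where
  open ≡-Reasoning
  x = recip c
  y = recip d

-- Harmonic numbers

harmonic : ℕ → ℚ
harmonic = partialSum (λ k → recip (suc k))

harmonic-mono : ∀ {m n} → m ≤ n → harmonic m ≤ℚ harmonic n
harmonic-mono = partialSum-increasing (λ k → 0≤recip (suc k))

0≤harmonic : ∀ n → 0ℚ ≤ℚ harmonic n
0≤harmonic n = harmonic-mono {0} {n} z≤n

-- Termwise from 2k+1 ≤ 2(k+1). It brings the harmonic numbers in the deviation under the control of
-- `b`, which is built from `S 1`.
harmonic≤2S : ∀ n → harmonic n ≤ℚ fromℕ 2 * S 1 n
harmonic≤2S n = ≤-trans
  (partialSum-mono-≤ (λ k → subst (λ z → recip (suc k) ≤ℚ fromℕ 2 * z) (sym (recipPow-1 (odd k)))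
    (recip≤2recip (suc k) (odd k) (subst (odd k ≤_) (sym (ℕ.*-suc 2 k)) (ℕ.n≤1+n (odd k))))) n)
  (≤-reflexive (partialSum-*ˡ (fromℕ 2) o n))

harmonic-increment : ∀ a d → harmonic (d ℕ.+ a) - harmonic a ≤ℚ fromℕ d * recip (suc a)
harmonic-increment a zero    = ≤-reflexive (trans (+-inverseʳ (harmonic a)) (sym (*-zeroˡ (recip (suc a)))))
harmonic-increment a (suc d) = begin
  harmonic (d ℕ.+ a) + recip (suc (d ℕ.+ a)) - harmonic a
    ≡⟨ solve 3 (λ x y z → x :+ y :- z := x :- z :+ y) refl
         (harmonic (d ℕ.+ a)) (recip (suc (d ℕ.+ a))) (harmonic a) ⟩
  harmonic (d ℕ.+ a) - harmonic a + recip (suc (d ℕ.+ a))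
    ≤⟨ +-mono-≤ (harmonic-increment a d) (recip-antimono (s≤s (ℕ.m≤n+m a d))) ⟩
  fromℕ d * recip (suc a) + recip (suc a)
    ≡⟨ solve 2 (λ d u → d :* u :+ u := (con 1ℚ :+ d) :* u) refl (fromℕ d) (recip (suc a)) ⟩
  (1ℚ + fromℕ d) * recip (suc a)          ≡⟨ cong (_* recip (suc a)) (fromℕ-+ 1 d) ⟨
  fromℕ (suc d) * recip (suc a)           ∎
  where open ≤-Reasoning

-- Functions of the difference of two indices

-- 1 / (a - b), with the value 0 when a = b
ρ : ℕ → ℕ → ℚ
ρ zero    zero    = 0ℚ
ρ (suc a) zero    = recip (suc a)
ρ zero    (suc b) = - recip (suc b)
ρ (suc a) (suc b) = ρ a b

-- The Kronecker delta with rational values, so that the case n = o enters as a summand and not as a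
-- case distinction.
δ : ℕ → ℕ → ℚ
δ zero    zero    = 1ℚ
δ (suc a) zero    = 0ℚ
δ zero    (suc b) = 0ℚ
δ (suc a) (suc b) = δ a b

-- 1 when b ≤ a, and 0 otherwise
θ : ℕ → ℕ → ℚ
θ a       zero    = 1ℚ
θ zero    (suc b) = 0ℚ
θ (suc a) (suc b) = θ a b

-- a - b when b ≤ a, and b - a - 1 otherwise
gap : ℕ → ℕ → ℕ
gap a       zero    = a
gap zero    (suc b) = b
gap (suc a) (suc b) = gap a b

fromℕ-suc-difference : ∀ a b → fromℕ (suc a) - fromℕ (suc b) ≡ fromℕ a - fromℕ b
fromℕ-suc-difference a b = trans (cong₂ _-_ (fromℕ-+ 1 a) (fromℕ-+ 1 b))
  (solve 2 (λ a b → (con 1ℚ :+ a) :- (con 1ℚ :+ b) := a :- b) refl (fromℕ a) (fromℕ b))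

difference*ρ : ∀ a b → (fromℕ a - fromℕ b) * ρ a b ≡ 1ℚ - δ a b
difference*ρ zero    zero    = refl
difference*ρ (suc a) zero    = trans (cong (_* recip (suc a)) (+-identityʳ (fromℕ (suc a)))) (fromℕ*recip (suc a))
difference*ρ zero    (suc b) = trans
  (solve 2 (λ b u → (con 0ℚ :- b) :* (:-′ u) := b :* u) refl (fromℕ (suc b)) (recip (suc b)))
  (fromℕ*recip (suc b))
difference*ρ (suc a) (suc b) = trans (cong (_* ρ a b) (fromℕ-suc-difference a b)) (difference*ρ a b)

δ*difference : ∀ a b → δ a b * (fromℕ a - fromℕ b) ≡ 0ℚ
δ*difference zero    zero    = refl
δ*difference (suc a) zero    = *-zeroˡ (fromℕ (suc a) - 0ℚ)
δ*difference zero    (suc b) = *-zeroˡ (0ℚ - fromℕ (suc b))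
δ*difference (suc a) (suc b) = trans (cong (δ a b *_) (fromℕ-suc-difference a b)) (δ*difference a b)

θ-suc : ∀ a b → θ (suc a) b ≡ θ a b + δ (suc a) b
θ-suc a       zero          = refl
θ-suc zero    (suc zero)    = refl
θ-suc zero    (suc (suc b)) = refl
θ-suc (suc a) (suc b)       = θ-suc a b

-- As a grows, the gap falls to 0 at a = b - 1, stays 0 at a = b, where ρ vanishes, and then rises.
-- The shift by one in the branch a < b of `gap` makes this hold on both sides of b.
harmonic-gap-suc : ∀ a b → harmonic (gap (suc a) b) ≡ harmonic (gap a b) + ρ (suc a) b
harmonic-gap-suc a       zero          = refl
harmonic-gap-suc zero    (suc zero)    = refl
harmonic-gap-suc zero    (suc (suc b)) =
  solve 2 (λ h u → h := h :+ u :+ (:-′ u)) refl (harmonic b) (recip (suc b))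
harmonic-gap-suc (suc a) (suc b)       = harmonic-gap-suc a b

0≤θ : ∀ a b → 0ℚ ≤ℚ θ a b
0≤θ a       zero    = 0≤fromℕ 1
0≤θ zero    (suc b) = ≤-refl
0≤θ (suc a) (suc b) = 0≤θ a b

θ≤1 : ∀ a b → θ a b ≤ℚ 1ℚ
θ≤1 a       zero    = ≤-refl
θ≤1 zero    (suc b) = 0≤fromℕ 1
θ≤1 (suc a) (suc b) = θ≤1 a b

θ-below : ∀ a c → θ a (suc (a ℕ.+ c)) ≡ 0ℚ
θ-below zero    c = refl
θ-below (suc a) c = θ-below a c

θ-above : ∀ b c → θ (b ℕ.+ c) b ≡ 1ℚ
θ-above zero    c = refl
θ-above (suc b) c = θ-above b c

gap-below : ∀ a c → gap a (suc (a ℕ.+ c)) ≡ c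
gap-below zero    c = refl
gap-below (suc a) c = gap-below a c

gap-above : ∀ b c → gap (b ℕ.+ c) b ≡ c
gap-above zero    c = refl
gap-above (suc b) c = gap-above b c

-- The bound `c` is kept apart from `a` because the induction lowers `a` and `b` together while `c`
-- stays fixed.
gap≤ : ∀ a b {c} → a ≤ c → b ≤ suc (a ℕ.+ c) → gap a b ≤ c
gap≤ a       zero    a≤c _         = a≤c
gap≤ zero    (suc b) _   (s≤s b≤c) = b≤c
gap≤ (suc a) (suc b) a<c (s≤s b≤)  = gap≤ a b (<⇒≤ a<c) b≤

ρ-below : ∀ a c → ρ a (a ℕ.+ suc c) ≡ - recip (suc c)
ρ-below zero    c = refl
ρ-below (suc a) c = ρ-below a c

-- The reflection o ↦ 2n - o of the odd numbers below 2n changes the sign of ρ n o;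
-- the induction peels off the outermost pair of terms.
Σρ≡0 : ∀ n → partialSum (λ k → ρ n (odd k)) n ≡ 0ℚ
Σρ≡0 zero          = refl
Σρ≡0 (suc zero)    = refl
Σρ≡0 (suc (suc n)) = begin
  partialSum (λ k → ρ (2 ℕ.+ n) (odd k)) (suc n) + ρ n (n ℕ.+ suc (n ℕ.+ 0))
    ≡⟨ cong₂ _+_ (partialSum-head (λ k → ρ (2 ℕ.+ n) (odd k)) n)
         (trans (ρ-below n (n ℕ.+ 0)) (cong (λ z → - recip (suc z)) (ℕ.+-identityʳ n))) ⟩
  u + partialSum (λ k → ρ n (k ℕ.+ suc (k ℕ.+ 0))) n - u
    -- Lowering both arguments of `ρ` by two turns the inner terms for n + 2 into all the terms for
    -- n.
    ≡⟨ cong (λ z → u + z - u) (trans (partialSum-cong (λ k → cong (ρ n) (ℕ.+-suc k (k ℕ.+ 0))) n) (Σρ≡0 n)) ⟩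
  u + 0ℚ - u
    ≡⟨ solve 1 (λ u → u :+ con 0ℚ :- u := con 0ℚ) refl u ⟩
  0ℚ ∎
  where
  open ≡-Reasoning
  u = recip (suc n)

-- Geometric sums in two unit fractions

module _ (c d : ℕ) .{{_ : NonZero c}} .{{_ : NonZero d}} where
  private
    x = recip c
    y = recip d

  δ*recip : δ c d * recip c ≡ δ c d * recip d
  δ*recip = sym (begin
    δ c d * y                                            ≡⟨ cong (δ c d *_) (recip-difference c d) ⟩
    δ c d * (x + x * y * (fromℕ c - fromℕ d))
      ≡⟨ solve 4 (λ e x y z → e :* (x :+ x :* y :* z) := e :* x :+ x :* y :* (e :* z)) refl
           (δ c d) x y (fromℕ c - fromℕ d) ⟩
    δ c d * x + x * y * (δ c d * (fromℕ c - fromℕ d))    ≡⟨ cong (λ z → δ c d * x + x * y * z) (δ*difference c d) ⟩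
    δ c d * x + x * y * 0ℚ
      ≡⟨ solve 3 (λ e x y → e :* x :+ x :* y :* con 0ℚ := e :* x) refl (δ c d) x y ⟩
    δ c d * x                                            ∎)
    where open ≡-Reasoning

  δ*recipPow : ∀ s → δ c d * recipPow c s ≡ δ c d * recipPow d s
  δ*recipPow zero    = refl
  δ*recipPow (suc s) = begin
    δ c d * recipPow c (suc s)      ≡⟨ cong (δ c d *_) (recipPow-suc c s) ⟩
    δ c d * (x * recipPow c s)      ≡⟨ *-assoc (δ c d) x (recipPow c s) ⟨
    δ c d * x * recipPow c s        ≡⟨ cong (_* recipPow c s) δ*recip ⟩
    δ c d * y * recipPow c s        ≡⟨ solve 3 (λ e y p → e :* y :* p := y :* (e :* p)) refl (δ c d) y (recipPow c s) ⟩
    y * (δ c d * recipPow c s)      ≡⟨ cong (y *_) (δ*recipPow s) ⟩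
    y * (δ c d * recipPow d s)      ≡⟨ solve 3 (λ e y p → y :* (e :* p) := e :* (y :* p)) refl (δ c d) y (recipPow d s) ⟩
    δ c d * (y * recipPow d s)      ≡⟨ cong (δ c d *_) (recipPow-suc d s) ⟨
    δ c d * recipPow d (suc s)      ∎
    where open ≡-Reasoning

  -- Partial fractions: 1/(d(c-d)) = 1/(c(c-d)) + 1/(cd) for c ≠ d. For c = d both `ρ` terms vanish
  -- and the `δ` term cancels 1/(cd).
  recip*ρ : recip d * ρ c d ≡ recip c * ρ c d + recip c * recip d - δ c d * (recip d * recip d)
  recip*ρ = begin
    y * r                                   ≡⟨ cong (_* r) (recip-difference c d) ⟩
    (x + x * y * z) * r
      ≡⟨ solve 4 (λ x y z r → (x :+ x :* y :* z) :* r := x :* r :+ x :* y :* (z :* r)) refl x y z r ⟩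
    x * r + x * y * (z * r)                 ≡⟨ cong (λ t → x * r + x * y * t) (difference*ρ c d) ⟩
    x * r + x * y * (1ℚ - e)
      ≡⟨ solve 4 (λ x y r e → x :* r :+ x :* y :* (con 1ℚ :- e) := x :* r :+ x :* y :- (e :* x) :* y) refl x y r e ⟩
    x * r + x * y - e * x * y               ≡⟨ cong (λ t → x * r + x * y - t * y) δ*recip ⟩
    x * r + x * y - e * y * y               ≡⟨ cong (λ t → x * r + x * y - t) (*-assoc e y y) ⟩
    x * r + x * y - e * (y * y)             ∎
    where
    open ≡-Reasoning
    z = fromℕ c - fromℕ d
    r = ρ c d
    e = δ c d

  -- With w = m + 2 and i = j + 1 the exponents are i and w - i; since j < m, the subtraction never
  -- truncates.
  geometricSum : ℕ → ℚ
  geometricSum m = partialSum (λ j → recipPow d (suc j) * recipPow c (suc m ∸ j)) m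

  -- The term of index 0 is split off rather than the last one: in the others the exponent of 1/c is
  -- already the one for m, and a factor 1/d comes out.
  geometricSum-suc : ∀ m → geometricSum (suc m) ≡
    recip d * (recip c * (recip c * recipPow c m)) + recip d * geometricSum m
  geometricSum-suc m = begin
    geometricSum (suc m)
      ≡⟨ partialSum-head (λ j → recipPow d (suc j) * recipPow c (suc (suc m) ∸ j)) m ⟩
    recipPow d 1 * recipPow c (2 ℕ.+ m) +
      partialSum (λ j → recipPow d (2 ℕ.+ j) * recipPow c (suc m ∸ j)) m
      ≡⟨ cong₂ _+_
           (cong₂ _*_ (recipPow-1 d) (trans (recipPow-suc c (suc m)) (cong (x *_) (recipPow-suc c m))))
           (trans
             (partialSum-cong (λ j → trans (cong (_* recipPow c (suc m ∸ j)) (recipPow-suc d (suc j)))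
                                           (*-assoc y (recipPow d (suc j)) (recipPow c (suc m ∸ j)))) m)
             (partialSum-*ˡ y (λ j → recipPow d (suc j) * recipPow c (suc m ∸ j)) m)) ⟩
    y * (x * (x * recipPow c m)) + y * geometricSum m ∎
    where open ≡-Reasoning

  -- Induction on m with `ρ` and `δ` as formal coefficients covers c = d and c ≠ d at once;
  -- `recip*ρ` is the only relation between them that the step needs, besides `δ*recipPow`.
  geometricSum-closed : ∀ m → geometricSum m ≡
    recip c * ρ c d * (recipPow d m - recipPow c m) + δ c d * (fromℕ m * recipPow d (2 ℕ.+ m))
  geometricSum-closed zero = sym
    (solve 4 (λ x r e p → x :* r :* (con 1ℚ :- con 1ℚ) :+ e :* (con 0ℚ :* p) := con 0ℚ) refl
      x (ρ c d) (δ c d) (recipPow d 2))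
  geometricSum-closed (suc m) = begin
    geometricSum (suc m)                                       ≡⟨ geometricSum-suc m ⟩
    y * (x * (x * X)) + y * geometricSum m                     ≡⟨ cong (λ t → y * (x * (x * X)) + y * t) (geometricSum-closed m) ⟩
    y * (x * (x * X)) + y * (x * r * (Y - X) + e * (M * recipPow d (2 ℕ.+ m)))
      ≡⟨ cong (λ t → y * (x * (x * X)) + y * (x * r * (Y - X) + e * (M * t))) Y₂ ⟩
    y * (x * (x * X)) + y * (x * r * (Y - X) + e * (M * (y * (y * Y))))
      ≡⟨ solve 7 (λ x y r e X Y M →
           y :* (x :* (x :* X)) :+ y :* (x :* r :* (Y :- X) :+ e :* (M :* (y :* (y :* Y))))
           := x :* r :* (y :* Y) :+ x :* X :* (x :* y :- y :* r) :+ e :* (M :* (y :* (y :* (y :* Y)))))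
           refl x y r e X Y M ⟩
    x * r * (y * Y) + x * X * (x * y - y * r) + e * (M * (y * (y * (y * Y))))
      ≡⟨ cong (λ t → x * r * (y * Y) + x * X * (x * y - t) + e * (M * (y * (y * (y * Y))))) recip*ρ ⟩
    x * r * (y * Y) + x * X * (x * y - (x * r + x * y - e * (y * y))) + e * (M * (y * (y * (y * Y))))
      ≡⟨ solve 7 (λ x y r e X Y M →
           x :* r :* (y :* Y) :+ x :* X :* (x :* y :- (x :* r :+ x :* y :- e :* (y :* y))) :+ e :* (M :* (y :* (y :* (y :* Y))))
           := x :* r :* (y :* Y :- x :* X) :+ y :* y :* (e :* (x :* X)) :+ e :* (M :* (y :* (y :* (y :* Y)))))
           refl x y r e X Y M ⟩
    x * r * (y * Y - x * X) + y * y * (e * (x * X)) + e * (M * (y * (y * (y * Y))))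
      -- Under `δ` the power of x becomes one of y, which supplies the copy of y^(m+3) that raises
      -- the coefficient from m to m + 1.
      ≡⟨ cong (λ t → x * r * (y * Y - x * X) + y * y * t + e * (M * (y * (y * (y * Y)))))
           (trans (cong (e *_) (sym (recipPow-suc c m)))
             (trans (δ*recipPow (suc m)) (cong (e *_) (recipPow-suc d m)))) ⟩
    x * r * (y * Y - x * X) + y * y * (e * (y * Y)) + e * (M * (y * (y * (y * Y))))
      ≡⟨ solve 7 (λ x y r e X Y M →
           x :* r :* (y :* Y :- x :* X) :+ y :* y :* (e :* (y :* Y)) :+ e :* (M :* (y :* (y :* (y :* Y))))
           := x :* r :* (y :* Y :- x :* X) :+ e :* ((con 1ℚ :+ M) :* (y :* (y :* (y :* Y)))))
           refl x y r e X Y M ⟩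
    x * r * (y * Y - x * X) + e * ((1ℚ + M) * (y * (y * (y * Y))))
      ≡⟨ cong₂ (λ p q → x * r * p + e * q)
           (cong₂ _-_ (recipPow-suc d m) (recipPow-suc c m))
           (cong₂ _*_ (fromℕ-+ 1 m) (trans (recipPow-suc d (2 ℕ.+ m)) (cong (y *_) Y₂))) ⟨
    x * r * (recipPow d (suc m) - recipPow c (suc m)) + e * (fromℕ (suc m) * recipPow d (3 ℕ.+ m)) ∎
    where
    open ≡-Reasoning
    r = ρ c d
    e = δ c d
    X = recipPow c m
    Y = recipPow d m
    M = fromℕ m

    Y₂ : recipPow d (2 ℕ.+ m) ≡ y * (y * Y)
    Y₂ = trans (recipPow-suc d (suc m)) (cong (y *_) (recipPow-suc d m))

-- Summation over n for a fixed odd number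

-- The closed form of the geometric sum without its x^m part, at denominators n + 1 and 2k + 1.
cell : (m n k : ℕ) → ℚ
cell m n k = recip (suc n) * (ρ (suc n) (odd k) * recipPow (odd k) m)
  + δ (suc n) (odd k) * (fromℕ m * recipPow (odd k) (2 ℕ.+ m))

-- What `cell` omits is `ρ` times a factor independent of k, and `Σρ≡0` removes it.
row-sum : ∀ m n → partialSum (λ k → geometricSum (suc n) (odd k) m) (suc n) ≡ partialSum (cell m n) (suc n)
row-sum m n = begin
  partialSum (λ k → geometricSum (suc n) (odd k) m) (suc n)
    ≡⟨ partialSum-cong (λ k → trans (geometricSum-closed (suc n) (odd k) m)
         (solve 5 (λ x r Y X E → x :* r :* (Y :- X) :+ E := (x :* (r :* Y) :+ E) :+ (:-′ (x :* X)) :* r) refl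
           x (ρ (suc n) (odd k)) (recipPow (odd k) m) X
           (δ (suc n) (odd k) * (fromℕ m * recipPow (odd k) (2 ℕ.+ m))))) (suc n) ⟩
  partialSum (λ k → cell m n k + (- (x * X)) * ρ (suc n) (odd k)) (suc n)
    ≡⟨ partialSum-+ (cell m n) (λ k → (- (x * X)) * ρ (suc n) (odd k)) (suc n) ⟩
  partialSum (cell m n) (suc n) + partialSum (λ k → (- (x * X)) * ρ (suc n) (odd k)) (suc n)
    ≡⟨ cong (λ t → partialSum (cell m n) (suc n) + t)
         (trans (partialSum-*ˡ (- (x * X)) (λ k → ρ (suc n) (odd k)) (suc n))
           (trans (cong ((- (x * X)) *_) (Σρ≡0 (suc n))) (*-zeroʳ (- (x * X))))) ⟩
  partialSum (cell m n) (suc n) + 0ℚ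
    ≡⟨ +-identityʳ (partialSum (cell m n) (suc n)) ⟩
  partialSum (cell m n) (suc n) ∎
  where
  open ≡-Reasoning
  x = recip (suc n)
  X = recipPow (suc n) m

-- An antidifference of `cell` in N that vanishes at N = k. For N ≥ k it is therefore the sum of
-- `cell m n k` over k ≤ n < N.
column : (m N k : ℕ) → ℚ
column m N k = θ N (odd k) * (fromℕ (suc m) * recipPow (odd k) (2 ℕ.+ m))
  - recipPow (odd k) (suc m) * (harmonic N - harmonic (gap N (odd k)))

-- For o = 2N + 1 the coefficient `θ` is 0 and the gap o - N - 1 is exactly N, so the harmonic
-- numbers cancel.
column-start : ∀ m N → column m N N ≡ 0ℚ
column-start m N = begin
  column m N N
    ≡⟨ cong₂ (λ t g → t * A - B * (harmonic N - harmonic g))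
         (θ-below N (N ℕ.+ 0)) (trans (gap-below N (N ℕ.+ 0)) (ℕ.+-identityʳ N)) ⟩
  0ℚ * A - B * (harmonic N - harmonic N)
    ≡⟨ solve 3 (λ A B h → con 0ℚ :* A :- B :* (h :- h) := con 0ℚ) refl A B (harmonic N) ⟩
  0ℚ ∎
  where
  open ≡-Reasoning
  A = fromℕ (suc m) * recipPow (odd N) (2 ℕ.+ m)
  B = recipPow (odd N) (suc m)

-- With x = 1/(n+1) and y = 1/o, the increment is δ (m+1) y^(m+2) - y^(m+1) (x - ρ). Partial
-- fractions rewrite y ρ; their correction -δ y² uses up one of the m + 1 diagonal copies and leaves
-- the m in `cell`.
column-suc : ∀ m n k → column m (suc n) k ≡ column m n k + cell m n k
column-suc m n k = begin
  θ (suc n) d * (fromℕ (suc m) * recipPow d (2 ℕ.+ m)) - recipPow d (suc m) * (h + x - harmonic (gap (suc n) d))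
    ≡⟨ cong₂ (λ s t → s * A - B * (h + x - t)) (θ-suc n d) (harmonic-gap-suc n d) ⟩
  (t + e) * A - B * (h + x - (g + r))
    ≡⟨ solve 8 (λ t e A B h x g r → (t :+ e) :* A :- B :* (h :+ x :- (g :+ r))
         := t :* A :- B :* (h :- g) :+ (e :* A :- B :* (x :- r))) refl t e A B h x g r ⟩
  t * A - B * (h - g) + (e * A - B * (x - r))
    ≡⟨ cong (λ z → t * A - B * (h - g) + z) step ⟩
  t * A - B * (h - g) + cell m n k ∎
  where
  open ≡-Reasoning
  d = odd k
  h = harmonic n
  g = harmonic (gap n d)
  x = recip (suc n)
  y = recip d
  r = ρ (suc n) d
  e = δ (suc n) d
  t = θ n d
  M = fromℕ m
  Y = recipPow d m
  A = fromℕ (suc m) * recipPow d (2 ℕ.+ m)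
  B = recipPow d (suc m)

  Y₂ : recipPow d (2 ℕ.+ m) ≡ y * (y * Y)
  Y₂ = trans (recipPow-suc d (suc m)) (cong (y *_) (recipPow-suc d m))

  step : e * A - B * (x - r) ≡ cell m n k
  step = begin
    e * A - B * (x - r)
      ≡⟨ cong₂ (λ p q → e * p - q * (x - r)) (cong₂ _*_ (fromℕ-+ 1 m) Y₂) (recipPow-suc d m) ⟩
    e * ((1ℚ + M) * (y * (y * Y))) - y * Y * (x - r)
      ≡⟨ solve 6 (λ e M y Y x r → e :* ((con 1ℚ :+ M) :* (y :* (y :* Y))) :- y :* Y :* (x :- r)
           := (y :* r) :* Y :- x :* y :* Y :+ e :* (y :* y) :* Y :+ e :* (M :* (y :* (y :* Y)))) refl e M y Y x r ⟩
    y * r * Y - x * y * Y + e * (y * y) * Y + e * (M * (y * (y * Y)))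
      ≡⟨ cong (λ z → z * Y - x * y * Y + e * (y * y) * Y + e * (M * (y * (y * Y)))) (recip*ρ (suc n) d) ⟩
    (x * r + x * y - e * (y * y)) * Y - x * y * Y + e * (y * y) * Y + e * (M * (y * (y * Y)))
      ≡⟨ solve 6 (λ e M y Y x r →
           (x :* r :+ x :* y :- e :* (y :* y)) :* Y :- x :* y :* Y :+ e :* (y :* y) :* Y :+ e :* (M :* (y :* (y :* Y)))
           := x :* (r :* Y) :+ e :* (M :* (y :* (y :* Y)))) refl e M y Y x r ⟩
    x * (r * Y) + e * (M * (y * (y * Y)))
      ≡⟨ cong (λ z → x * (r * Y) + e * (M * z)) Y₂ ⟨
    cell m n k ∎

-- Exchange of summation over the triangle k ≤ n < N, by induction on N: a new row extends every
-- column by one cell.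
triangle-sum : ∀ m N →
  partialSum (λ n → partialSum (cell m n) (suc n)) N ≡ partialSum (column m N) N
triangle-sum m zero    = refl
triangle-sum m (suc N) = begin
  partialSum (λ n → partialSum (cell m n) (suc n)) N + partialSum (cell m N) (suc N)
    ≡⟨ cong (_+ partialSum (cell m N) (suc N)) (triangle-sum m N) ⟩
  partialSum (column m N) N + partialSum (cell m N) (suc N)
    ≡⟨ cong (_+ partialSum (cell m N) (suc N)) (+-identityʳ (partialSum (column m N) N)) ⟨
  partialSum (column m N) N + 0ℚ + partialSum (cell m N) (suc N)
    -- The column k = N, still empty, is appended so that the columns match the N + 1 cells of the
    -- new row.
    ≡⟨ cong (λ z → partialSum (column m N) N + z + partialSum (cell m N) (suc N)) (column-start m N) ⟨
  partialSum (column m N) (suc N) + partialSum (cell m N) (suc N)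
    ≡⟨ partialSum-+ (column m N) (cell m N) (suc N) ⟨
  partialSum (λ k → column m N k + cell m N k) (suc N)
    ≡⟨ partialSum-cong (column-suc m N) (suc N) ⟨
  partialSum (column m (suc N)) (suc N) ∎
  where open ≡-Reasoning

-- An exact identity between finite sums: for each n, exchanging the sums over j and k produces the
-- geometric sums of `row-sum`. Limits enter only afterwards.
σ-sum : ∀ m N → partialSum (λ j → partialSum (σ-term (suc m ∸ j) (suc j)) N) m ≡ partialSum (column m N) N
σ-sum m N = begin
  partialSum (λ j → partialSum (σ-term (suc m ∸ j) (suc j)) N) m
    ≡⟨ partialSum-swap (λ j → σ-term (suc m ∸ j) (suc j)) m N ⟩
  partialSum (λ n → partialSum (λ j → σ-term (suc m ∸ j) (suc j) n) m) N
    ≡⟨ partialSum-cong (λ n → trans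
         (partialSum-cong (λ j → sym (partialSum-*ʳ (recipPow (suc n) (suc m ∸ j))
                                       (λ k → recipPow (odd k) (suc j)) (suc n))) m)
         (trans (partialSum-swap (λ j k → recipPow (odd k) (suc j) * recipPow (suc n) (suc m ∸ j)) m (suc n))
                (row-sum m n))) N ⟩
  partialSum (λ n → partialSum (cell m n) (suc n)) N
    ≡⟨ triangle-sum m N ⟩
  partialSum (column m N) N ∎
  where open ≡-Reasoning

-- The deviation from the limit

-- What `column` lacks of (m+1) y^(m+2), arranged as two products whose signs can be read off.
error : (m N k : ℕ) → ℚ
error m N k = (1ℚ - θ N (odd k)) * (fromℕ (suc m) * recipPow (odd k) (2 ℕ.+ m))
  + recipPow (odd k) (suc m) * (harmonic N - harmonic (gap N (odd k)))

column+error : ∀ m N k → column m N k + error m N k ≡ fromℕ (suc m) * lambda-term (2 ℕ.+ m) k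
column+error m N k =
  solve 4 (λ t A B h → (t :* A :- B :* h) :+ ((con 1ℚ :- t) :* A :+ B :* h) := A) refl
    (θ N (odd k)) (fromℕ (suc m) * recipPow (odd k) (2 ℕ.+ m))
    (recipPow (odd k) (suc m)) (harmonic N - harmonic (gap N (odd k)))

-- From k < N follows o ≤ 2N + 1, so the gap is at most N and its harmonic number at most H_N.
0≤error : ∀ m N k → k ℕ.< N → 0ℚ ≤ℚ error m N k
0≤error m N k k<N = 0≤+
  (0≤* (p≤q⇒0≤q-p (θ≤1 N (odd k))) (0≤* (0≤fromℕ (suc m)) (0≤recipPow (odd k) (2 ℕ.+ m))))
  (0≤* (0≤recipPow (odd k) (suc m)) (p≤q⇒0≤q-p (harmonic-mono
    (gap≤ N (odd k) ℕ.≤-refl (s≤s (ℕ.+-mono-≤ (<⇒≤ k<N) (subst (_≤ N) (sym (ℕ.+-identityʳ k)) (<⇒≤ k<N))))))))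

-- The first summand serves 2o ≤ N and the second N ≤ 2o; their sum is one bound for all k.
errorBound : (m N k : ℕ) .{{_ : NonZero N}} → ℚ
errorBound m N k = fromℕ 2 * recip N * recip (odd k)
  + fromℕ 4 * (recip N * recip N) * (fromℕ (suc m) + harmonic N)

-- Here `θ` is 1 and the gap is a = N - o ≥ N/2. Hence H_N - H_a ≤ o/(a+1) ≤ 2o/N, and y^(m+1) ≤ y²
-- leaves 2/(N o).
error≤-small : ∀ m n k → 1 ≤ m → 2 ℕ.* odd k ≤ suc n → error m (suc n) k ≤ℚ errorBound m (suc n) k
error≤-small m n k 1≤m 2d≤N = begin
  (1ℚ - θ N d) * A + B * (harmonic N - harmonic (gap N d))
    ≡⟨ cong₂ (λ t g → (1ℚ - t) * A + B * (harmonic N - harmonic g))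
         (subst (λ z → θ z d ≡ 1ℚ) d+a≡N (θ-above d a)) (subst (λ z → gap z d ≡ a) d+a≡N (gap-above d a)) ⟩
  (1ℚ - 1ℚ) * A + B * (harmonic N - harmonic a)
    ≡⟨ solve 2 (λ A C → (con 1ℚ :- con 1ℚ) :* A :+ C := C) refl A (B * (harmonic N - harmonic a)) ⟩
  B * (harmonic N - harmonic a)
    ≤⟨ *-mono-≤ (0≤recipPow d (suc m)) (0≤* (0≤fromℕ d) (0≤recip (suc a))) B≤y²
         (subst (λ z → harmonic z - harmonic a ≤ℚ fromℕ d * recip (suc a)) d+a≡N (harmonic-increment a d)) ⟩
  y * y * (fromℕ d * recip (suc a))
    ≡⟨ solve 3 (λ y d u → y :* y :* (d :* u) := (d :* y) :* (u :* y)) refl y (fromℕ d) (recip (suc a)) ⟩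
  fromℕ d * y * (recip (suc a) * y)
    ≡⟨ trans (cong (_* (recip (suc a) * y)) (fromℕ*recip d)) (*-identityˡ (recip (suc a) * y)) ⟩
  recip (suc a) * y
    ≤⟨ *-monoʳ-≤-nonNeg y {{nonNegative (0≤recip d)}} (recip≤2recip (suc a) N N≤2a+2) ⟩
  fromℕ 2 * x * y
    ≡⟨ +-identityʳ (fromℕ 2 * x * y) ⟨
  fromℕ 2 * x * y + 0ℚ
    ≤⟨ +-monoʳ-≤ (fromℕ 2 * x * y) (0≤* (0≤* (0≤fromℕ 4) (0≤* (0≤recip N) (0≤recip N)))
         (0≤+ (0≤fromℕ (suc m)) (0≤harmonic N))) ⟩
  fromℕ 2 * x * y + fromℕ 4 * (x * x) * (M + harmonic N) ∎
  where
  open ≤-Reasoning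
  N = suc n
  d = odd k
  a = N ∸ d
  x = recip N
  y = recip d
  M = fromℕ (suc m)
  A = M * recipPow d (2 ℕ.+ m)
  B = recipPow d (suc m)

  d+a≡N : d ℕ.+ a ≡ N
  d+a≡N = ℕ.m+[n∸m]≡n (ℕ.≤-trans (ℕ.m≤n*m d 2) 2d≤N)

  N≤2a+2 : N ≤ 2 ℕ.* suc a
  N≤2a+2 = subst (_≤ 2 ℕ.* suc a) d+a≡N
    (ℕ.+-mono-≤ (ℕ.m≤n⇒m≤1+n (ℕ.m+n≤o⇒m≤o∸n d (subst (_≤ N) (cong (d ℕ.+_) (ℕ.+-identityʳ d)) 2d≤N)))
                (ℕ.≤-trans (ℕ.n≤1+n a) (ℕ.m≤m+n (suc a) 0)))

  B≤y² : B ≤ℚ y * y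
  B≤y² = subst (B ≤ℚ_) (recipPow-2 d) (recipPow-antimono {d} {d} ℕ.≤-refl (s≤s 1≤m))

-- Now y ≤ 2/N, so both powers of y are at most 4/N², while 1 - θ ≤ 1 and the harmonic difference is
-- at most H_N.
error≤-large : ∀ m n k → 1 ≤ m → suc n ≤ 2 ℕ.* odd k → error m (suc n) k ≤ℚ errorBound m (suc n) k
error≤-large m n k 1≤m N≤2d = begin
  (1ℚ - θ N d) * (M * recipPow d (2 ℕ.+ m)) + recipPow d (suc m) * (harmonic N - harmonic (gap N d))
    ≤⟨ +-mono-≤
         (*-mono-≤ (p≤q⇒0≤q-p (θ≤1 N d)) (0≤* (0≤fromℕ (suc m)) 0≤z) (p-q≤p 1ℚ (0≤θ N d))
           (*-monoˡ-≤-nonNeg M {{nonNegative (0≤fromℕ (suc m))}} (pow≤z (2 ℕ.+ m) (ℕ.m≤m+n 2 m))))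
         (*-mono-≤ (0≤recipPow d (suc m)) (0≤harmonic N) (pow≤z (suc m) (s≤s 1≤m))
           (p-q≤p (harmonic N) (0≤harmonic (gap N d)))) ⟩
  1ℚ * (M * z) + z * harmonic N
    ≡⟨ solve 3 (λ M x h → con 1ℚ :* (M :* (con (fromℕ 2) :* x :* (con (fromℕ 2) :* x)))
                             :+ con (fromℕ 2) :* x :* (con (fromℕ 2) :* x) :* h
                         := con 0ℚ :+ con (fromℕ 4) :* (x :* x) :* (M :+ h)) refl M x (harmonic N) ⟩
  0ℚ + fromℕ 4 * (x * x) * (M + harmonic N)
    ≤⟨ +-monoˡ-≤ (fromℕ 4 * (x * x) * (M + harmonic N)) (0≤* (0≤* (0≤fromℕ 2) (0≤recip N)) (0≤recip d)) ⟩
  fromℕ 2 * x * y + fromℕ 4 * (x * x) * (M + harmonic N) ∎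
  where
  open ≤-Reasoning
  N = suc n
  d = odd k
  x = recip N
  y = recip d
  z = fromℕ 2 * x * (fromℕ 2 * x)
  M = fromℕ (suc m)

  0≤2x : 0ℚ ≤ℚ fromℕ 2 * x
  0≤2x = 0≤* (0≤fromℕ 2) (0≤recip N)

  0≤z : 0ℚ ≤ℚ z
  0≤z = 0≤* 0≤2x 0≤2x

  y≤2x : y ≤ℚ fromℕ 2 * x
  y≤2x = recip≤2recip d N N≤2d

  pow≤z : ∀ s → 2 ≤ s → recipPow d s ≤ℚ z
  pow≤z s 2≤s = ≤-trans (recipPow-antimono {d} {d} ℕ.≤-refl 2≤s)
    (subst (_≤ℚ z) (sym (recipPow-2 d)) (*-mono-≤ (0≤recip d) 0≤2x y≤2x y≤2x))

  p-q≤p : ∀ p {q} → 0ℚ ≤ℚ q → p - q ≤ℚ p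
  p-q≤p p {q} 0≤q = subst (p - q ≤ℚ_) (+-identityʳ p) (+-monoʳ-≤ p (neg-antimono-≤ 0≤q))

error≤ : ∀ m n k → 1 ≤ m → error m (suc n) k ≤ℚ errorBound m (suc n) k
error≤ m n k 1≤m = [ error≤-small m n k 1≤m , error≤-large m n k 1≤m ]′ (ℕ.≤-total (2 ℕ.* odd k) (suc n))

-- With s = `S 1 N` the summed bounds are at most (10 s + 4(m+1))/N, where 10 = 2 + 4·2 and the last
-- 2 comes from `harmonic≤2S`.
errorFactor : ℕ → ℕ
errorFactor m = 10 ℕ.+ 4 ℕ.* suc m

Σerror≤ : ∀ m n → 1 ≤ m → partialSum (error m (suc n)) (suc n) ≤ℚ fromℕ (errorFactor m) * b n
Σerror≤ m n 1≤m = begin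
  partialSum (error m N) N
    ≤⟨ partialSum-mono-≤ (λ k → error≤ m n k 1≤m) N ⟩
  partialSum (λ k → fromℕ 2 * x * recip (odd k) + c) N
    ≡⟨ partialSum-+ (λ k → fromℕ 2 * x * recip (odd k)) (λ _ → c) N ⟩
  partialSum (λ k → fromℕ 2 * x * recip (odd k)) N + partialSum (λ _ → c) N
    ≡⟨ cong₂ _+_
         (trans (partialSum-*ˡ (fromℕ 2 * x) (λ k → recip (odd k)) N)
                (cong (fromℕ 2 * x *_) (partialSum-cong (λ k → sym (recipPow-1 (odd k))) N)))
         (partialSum-const c N) ⟩
  fromℕ 2 * x * s + fromℕ N * c
    ≡⟨ solve 5 (λ x s N M h → con (fromℕ 2) :* x :* s :+ N :* (con (fromℕ 4) :* (x :* x) :* (M :+ h))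
         := con (fromℕ 2) :* x :* s :+ (N :* x) :* (con (fromℕ 4) :* x) :* (M :+ h)) refl x s (fromℕ N) M h ⟩
  fromℕ 2 * x * s + fromℕ N * x * (fromℕ 4 * x) * (M + h)
    ≡⟨ cong (λ z → fromℕ 2 * x * s + z * (fromℕ 4 * x) * (M + h)) (fromℕ*recip N) ⟩
  fromℕ 2 * x * s + 1ℚ * (fromℕ 4 * x) * (M + h)
    ≡⟨ cong (λ z → fromℕ 2 * x * s + z * (M + h)) (*-identityˡ (fromℕ 4 * x)) ⟩
  fromℕ 2 * x * s + fromℕ 4 * x * (M + h)
    ≤⟨ +-monoʳ-≤ (fromℕ 2 * x * s) (*-monoˡ-≤-nonNeg (fromℕ 4 * x)
         {{nonNegative (0≤* (0≤fromℕ 4) (0≤recip N))}} (+-monoʳ-≤ M (harmonic≤2S N))) ⟩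
  fromℕ 2 * x * s + fromℕ 4 * x * (M + fromℕ 2 * s)
    ≡⟨ +-identityʳ (fromℕ 2 * x * s + fromℕ 4 * x * (M + fromℕ 2 * s)) ⟨
  fromℕ 2 * x * s + fromℕ 4 * x * (M + fromℕ 2 * s) + 0ℚ
    -- The nonnegative terms added here complete 10 s + 4M to the product (10 + 4M)(s + 1).
    ≤⟨ +-monoʳ-≤ (fromℕ 2 * x * s + fromℕ 4 * x * (M + fromℕ 2 * s))
         (0≤+ (0≤* (0≤fromℕ 10) (0≤recip N)) (0≤* (0≤* (0≤fromℕ 4) (0≤fromℕ (suc m))) (0≤* (0≤S 1 N) (0≤recip N)))) ⟩
  fromℕ 2 * x * s + fromℕ 4 * x * (M + fromℕ 2 * s) + (fromℕ 10 * x + fromℕ 4 * M * (s * x))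
    ≡⟨ solve 3 (λ x s M → con (fromℕ 2) :* x :* s :+ con (fromℕ 4) :* x :* (M :+ con (fromℕ 2) :* s)
                            :+ (con (fromℕ 10) :* x :+ con (fromℕ 4) :* M :* (s :* x))
         := (con (fromℕ 10) :+ con (fromℕ 4) :* M) :* ((s :+ con 1ℚ) :* x)) refl x s M ⟩
  (fromℕ 10 + fromℕ 4 * M) * b n
    ≡⟨ cong (_* b n) (trans (fromℕ-+ 10 (4 ℕ.* suc m)) (cong (λ z → fromℕ 10 + z) (fromℕ-* 4 (suc m)))) ⟨
  fromℕ (errorFactor m) * b n ∎
  where
  open ≤-Reasoning
  N = suc n
  x = recip N
  s = S 1 N
  h = harmonic N
  M = fromℕ (suc m)
  c = fromℕ 4 * (x * x) * (M + h)

0≤Σerror : ∀ m N → 0ℚ ≤ℚ partialSum (error m N) N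
0≤Σerror m N = subst (_≤ℚ partialSum (error m N) N)
  (trans (partialSum-const 0ℚ N) (*-zeroʳ (fromℕ N)))
  (partialSum-mono-< N (0≤error m N))

fromℕ*b-small : ∀ c q n → let r = c ℕ.+ q ℕ.* suc c in
  suc r ℕ.* (2 ℕ.+ suc r) ≤ suc n → fromℕ (suc c) * b n ≤ℚ recip (suc q)
fromℕ*b-small c q n large = begin
  C * b n                                ≤⟨ *-monoˡ-≤-nonNeg C {{nonNegative (0≤fromℕ (suc c))}} (b-small (c ℕ.+ q ℕ.* suc c) n large) ⟩
  -- `suc r` computes to `suc q * suc c`, so multiplying by c + 1 leaves 1/(q+1).
  C * recip (suc q ℕ.* suc c)            ≡⟨ cong (C *_) (recip-* (suc q) (suc c)) ⟩
  C * (recip (suc q) * recip (suc c))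
    ≡⟨ solve 3 (λ C u v → C :* (u :* v) := (C :* v) :* u) refl C (recip (suc q)) (recip (suc c)) ⟩
  C * recip (suc c) * recip (suc q)      ≡⟨ cong (_* recip (suc q)) (fromℕ*recip (suc c)) ⟩
  1ℚ * recip (suc q)                     ≡⟨ *-identityˡ (recip (suc q)) ⟩
  recip (suc q)                          ∎
  where
  open ≤-Reasoning
  C = fromℕ (suc c)

b-null : ∀ c ε → 0ℚ < ε → ∃[ N ] (∀ n → N ≤ suc n → fromℕ (suc c) * b n < ε)
b-null c ε 0<ε =
  let q , recip<ε = archimedean ε 0<ε
      r = c ℕ.+ q ℕ.* suc c
  in suc r ℕ.* (2 ℕ.+ suc r) , λ n large → ≤-<-trans (fromℕ*b-small c q n large) recip<ε

Σerror-null : ∀ m ε → 1 ≤ m → 0ℚ < ε → ∃[ N ] (∀ n → N ≤ n → partialSum (error m n) n < ε)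
-- `b-null` multiplies by the successor of its argument, here 10 + 4(m+1), which is `errorFactor m`.
Σerror-null m ε 1≤m 0<ε = let N , small = b-null (9 ℕ.+ 4 ℕ.* suc m) ε 0<ε in N , below N small
  where
  below : ∀ N → (∀ n → N ≤ suc n → fromℕ (errorFactor m) * b n < ε) →
          ∀ n → N ≤ n → partialSum (error m n) n < ε
  -- The sum is empty at 0, where `errorBound` is not defined.
  below N small zero    _   = 0<ε
  below N small (suc n) N≤n = ≤-<-trans (Σerror≤ m n 1≤m) (small n N≤n)

-- Passage to the limit

≃ℝ-from-below : ∀ x y (e : ℕ → ℚ) → (∀ n → seq y n ≡ seq x n + e n) → (∀ n → 0ℚ ≤ℚ e n) →
  (∀ ε → 0ℚ < ε → ∃[ N ] (∀ n → N ≤ n → e n < ε)) → x ≃ℝ y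
≃ℝ-from-below x y e y≡x+e 0≤e e-null ε 0<ε with e-null ε 0<ε
... | N , small = N , λ n N≤n → ∣p∣<ε
  (≤-<-trans (subst (_≤ℚ 0ℚ) (sym (x-y n)) (neg-antimono-≤ (0≤e n))) 0<ε)
  (subst (_< ε) (sym (trans (cong -_ (x-y n)) (solve 1 (λ e → :-′ (:-′ e) := e) refl (e n)))) (small n N≤n))
  where
  x-y : ∀ n → seq x n - seq y n ≡ - e n
  x-y n = trans (cong (λ z → seq x n - z) (y≡x+e n))
    (solve 2 (λ x e → x :- (x :+ e) := :-′ e) refl (seq x n) (e n))

-- Matching w as m + 2 lets the truncated subtractions in w compute to the exponents of `σ-sum`.
σ-sum-weight : ∀ w N → 2 ≤ w →
  partialSum (λ j → partialSum (σ-term (w ∸ suc j) (suc j)) N) (w ∸ 2) ≡ partialSum (column (w ∸ 2) N) N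
σ-sum-weight (suc (suc m)) N _ = σ-sum m N
σ-sum-weight (suc zero) N (s≤s ())

lambda-sum : ∀ m N →
  fromℕ (suc m) * partialSum (lambda-term (2 ℕ.+ m)) N ≡ partialSum (column m N) N + partialSum (error m N) N
lambda-sum m N = begin
  fromℕ (suc m) * partialSum (lambda-term (2 ℕ.+ m)) N          ≡⟨ partialSum-*ˡ (fromℕ (suc m)) (lambda-term (2 ℕ.+ m)) N ⟨
  partialSum (λ k → fromℕ (suc m) * lambda-term (2 ℕ.+ m) k) N  ≡⟨ partialSum-cong (column+error m N) N ⟨
  partialSum (λ k → column m N k + error m N k) N               ≡⟨ partialSum-+ (column m N) (error m N) N ⟩
  partialSum (column m N) N + partialSum (error m N) N          ∎
  where open ≡-Reasoning

lambda-sum-weight : ∀ w N → 2 ≤ w →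
  fromℕ (w ∸ 1) * partialSum (lambda-term w) N ≡ partialSum (column (w ∸ 2) N) N + partialSum (error (w ∸ 2) N) N
lambda-sum-weight (suc (suc m)) N _ = lambda-sum m N
lambda-sum-weight (suc zero) N (s≤s ())

mainTheorem1 : (w : ℕ) (3≤w : 3 ≤ w) →
    sumℝ {w ∸ 2} (λ i → σ (w ∸ suc (toℕ i)) (suc (toℕ i)) (i≤w-2⇒2≤w-i w 3≤w i) (s≤s z≤n))
    ≃ℝ (w ∸ 1) ·ℝ lambda w (<⇒≤ 3≤w)
mainTheorem1 w 3≤w = ≃ℝ-from-below L R (λ N → partialSum (error (w ∸ 2) N) N) R≡L+error (0≤Σerror (w ∸ 2))
  -- w ≥ 3 becomes 1 ≤ m, which gives y^(m+1) ≤ y² in the error bounds.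
  (λ ε → Σerror-null (w ∸ 2) ε (ℕ.∸-monoˡ-≤ 2 3≤w))
  where
  L R : ℝ
  L = sumℝ {w ∸ 2} (λ i → σ (w ∸ suc (toℕ i)) (suc (toℕ i)) (i≤w-2⇒2≤w-i w 3≤w i) (s≤s z≤n))
  R = (w ∸ 1) ·ℝ lambda w (<⇒≤ 3≤w)

  L≡ : ∀ N → seq L N ≡ partialSum (column (w ∸ 2) N) N
  L≡ N = trans
    (seq-sumℝ (λ i → σ (w ∸ suc (toℕ i)) (suc (toℕ i)) (i≤w-2⇒2≤w-i w 3≤w i) (s≤s z≤n))
              (λ j → partialSum (σ-term (w ∸ suc j) (suc j)) N) N (λ _ → refl))
    (σ-sum-weight w N (<⇒≤ 3≤w))

  R≡L+error : ∀ N → seq R N ≡ seq L N + partialSum (error (w ∸ 2) N) N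
  R≡L+error N = trans (seq-·ℝ (w ∸ 1) (lambda w (<⇒≤ 3≤w)) N)
    (trans (lambda-sum-weight w N (<⇒≤ 3≤w)) (cong (_+ partialSum (error (w ∸ 2) N) N) (sym (L≡ N))))
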